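{- For every $r\in\mathbb N$, the four Schurian polynomial approximation schemes $\mathcal S_{\mathbf{WL}}$, $\mathcal S_{\mathbf C}$, $\mathcal S_{\mathbf{WL},r}$ and $\mathcal S_{\mathbf C,r}$ are pairwise equivalent: $\mathcal S_{\mathbf{WL}}\simeq\mathcal S_{\mathbf C}\simeq\mathcal S_{\mathbf{WL},r}\simeq\mathcal S_{\mathbf C,r}$.
   Context: All sets are finite. $[k]=\{1,\dots,k\}$; for $r\le k$, $[k]^{(r)}$ is the set of $r$-tuples of pairwise distinct elements of $[k]$. A labelled partition of a set $A$ is a function $\gamma:A\to L$ (arbitrary codomain); $\mathcal P(A)$ is the class of these. For $\gamma,\rho\in\mathcal P(A)$ write $\gamma\preceq\rho$ if $\rho(a)=\rho(b)\Rightarrow\gamma(a)=\gamma(b)$ for all $a,b$, and $\gamma\approx\rho$ if $\gamma\preceq\rho$ and $\rho\preceq\gamma$. For $\vec v\in V^k$, $\vec i\in[k]^{(r)}$, $\vec u\in V^r$, the tuple $\vec v\langle\vec i,\vec u\rangle\in V^k$ is obtained from $\vec v$ by putting $u_s$ in position $i_s$ for each $s\in[r]$, other entries unchanged. For $\gamma\in\mathcal P(V^k)$ and $t\le k$, $\mathrm{pr}_t\gamma\in\mathcal P(V^t)$ is $\mathrm{pr}_t\gamma(w_1,\dots,w_t)=\gamma(w_1,\dots,w_t,w_t,\dots,w_t)$. A graph with vertex set $V$ is a labelled partition $\Gamma$ of $V^2$; its automorphisms are the permutations $g$ of $V$ with $\Gamma(g u,g v)=\Gamma(u,v)$; $\mathrm{Sch}(\Gamma)$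 is the partition of $V^2$ into orbits of $\mathrm{Aut}(\Gamma)$. The atomic type partition is $\alpha_{k,\Gamma}(\vec v)=(\Gamma(v_i,v_j))_{(i,j)\in[k]^{(2)}}$. A $k$-refinement operator $R$ assigns to every finite set $V$ and $\gamma\in\mathcal P(V^k)$ some $R\circ\gamma\in\mathcal P(V^k)$ with $\gamma\preceq R\circ\gamma$; $\gamma$ is $R$-stable if $\gamma\approx R\circ\gamma$; $[\gamma]^R$ is the first $R$-stable term of the sequence $X^0=\gamma$, $X^i=R\circ X^{i-1}$. For a family $\mathbf R=\{R_1,R_2,\dots\}$ ($R_k$ a $k$-refinement operator) put $\overline R_1(\Gamma)=\Gamma$ and $\overline R_k(\Gamma)=\mathrm{pr}_2[\alpha_{k,\Gamma}]^{R_k}$ for $k\ge2$, and $\mathcal S_{\mathbf R}=\{\overline R_1,\overline R_2,\dots\}$. Operators: for $k\le r$, $\mathrm{WL}_{k,r}\circ\gamma=\mathrm C_{k,r}\circ\gamma=\gamma$. For $r<k$: $\mathrm{WL}_{k,r}\circ\gamma(\vec v)=\big(\gamma(\vec v),\{\{(\gamma(\vec v\langle\vec i,\vec x\rangle))_{\vec i\in[k]^{(r)}}:\vec x\in V^r\}\}\big)$ and $\mathrm C_{k,r}\circ\gamma(\vec v)=\big(\gamma(\vec v),(\{\{\gamma(\vec v\langle\vec i,\vec x\rangle):\vec x\in V^r\}\})_{\vec i\in[k]^{(r)}}\big)$, where $\{\{\cdot\}\}$ denotes a multiset. $\mathbf{WL}_r=\{\mathrm{WL}_{1,r},\mathrm{WL}_{2,r},\dots\}$,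 $\mathbf C_r=\{\mathrm C_{1,r},\mathrm C_{2,r},\dots\}$, $\mathcal S_{\mathbf{WL},r}=\mathcal S_{\mathbf{WL}_r}$, $\mathcal S_{\mathbf C,r}=\mathcal S_{\mathbf C_r}$, and $\mathcal S_{\mathbf{WL}}=\mathcal S_{\mathbf{WL},1}$, $\mathcal S_{\mathbf C}=\mathcal S_{\mathbf C,1}$. For two such schemes $\mathcal S_X=\{X_k\}$, $\mathcal S_Y=\{Y_k\}$: $\mathcal S_Y\preceq\mathcal S_X$ ($\mathcal S_X$ dominates $\mathcal S_Y$) if for every $k$ there is $k'$ with $Y_k(\Gamma)\preceq X_{k'}(\Gamma)$ for all graphs $\Gamma$; $\mathcal S_X\simeq\mathcal S_Y$ if both $\mathcal S_X\preceq\mathcal S_Y$ and $\mathcal S_Y\preceq\mathcal S_X$. -}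

module Defs where

open import Level using (0ℓ)
open import Data.Unit using (⊤)
open import Data.Nat using (ℕ; zero; suc; _+_; _≤_; _≤?_)
open import Data.Fin using (Fin) renaming (zero to fzero; suc to fsuc)
open import Data.Vec using (Vec; []; _∷_; lookup; _[_]≔_; _++_; replicate; last)
open import Data.Product using (Σ; _×_; _,_; proj₁; proj₂; ∃)
open import Data.Product.Relation.Binary.Pointwise.NonDependent using (×-setoid)
open import Relation.Binary using (Setoid)
open import Relation.Binary.PropositionalEquality using (_≡_; refl; subst)
open import Relation.Nullary using (¬_; yes; no)
open import Function.Bundles using (_↔_; Inverse)
open import Function.Properties.Inverse using (↔-refl; ↔-sym; ↔-trans)

-- Labelled partitions.  A labelled partition of A is a labelling
-- function into an (arbitrary) codomain of labels.  Codomains are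
-- setoids, so that composite labels (tuples, multisets) can be compared
-- with their natural equality.

record LP (A : Set) : Set₁ where
  field
    Lab : Setoid 0ℓ 0ℓ
    lab : A → Setoid.Carrier Lab
open LP public

Same : ∀ {A} (γ : LP A) → A → A → Set
Same γ a b = Setoid._≈_ (Lab γ) (lab γ a) (lab γ b)

_⪯_ : ∀ {A} → LP A → LP A → Set
γ ⪯ ρ = ∀ a b → Same ρ a b → Same γ a b

_≈P_ : ∀ {A} → LP A → LP A → Set
γ ≈P ρ = (γ ⪯ ρ) × (ρ ⪯ γ)

Fam : Set → Setoid 0ℓ 0ℓ → Setoid 0ℓ 0ℓ
Fam I S = record
  { Carrier = I → Carrier
  ; _≈_ = λ f g → ∀ i → f i ≈ g i
  ; isEquivalence = record
      { refl = λ i → refl′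
      ; sym = λ p i → sym′ (p i)
      ; trans = λ p q i → trans′ (p i) (q i) } }
  where open Setoid S renaming (refl to refl′; sym to sym′; trans to trans′)

-- the multiset {{ f x : x ∈ I }} of a family over a finite index set I:
-- two families give the same multiset iff they agree up to a
-- bijection of the index set.
MSet : Set → Setoid 0ℓ 0ℓ → Setoid 0ℓ 0ℓ
MSet I S = record
  { Carrier = I → Carrier
  ; _≈_ = λ f g → Σ (I ↔ I) λ σ → ∀ i → f i ≈ g (Inverse.to σ i)
  ; isEquivalence = record
      { refl = ↔-refl , λ i → refl′
      ; sym = λ { {f} {g} (σ , p) → ↔-sym σ , λ j →
                  sym′ (subst (λ z → f (Inverse.from σ j) ≈ g z)
                              (Inverse.strictlyInverseˡ σ j) (p (Inverse.from σ j))) }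
      ; trans = λ { (σ , p) (τ , q) → ↔-trans σ τ , λ i → trans′ (p i) (q _) } } }
  where open Setoid S renaming (refl to refl′; sym to sym′; trans to trans′)

-- Tuples.  We take V = Fin n (every finite set is in bijection with one).

Tup : ℕ → ℕ → Set
Tup n k = Vec (Fin n) k

Inj : ℕ → ℕ → Set
Inj k r = Σ (Vec (Fin k) r) λ i → ∀ a b → lookup i a ≡ lookup i b → a ≡ b

_⟨_,_⟩ : ∀ {A : Set} {k r} → Vec A k → Vec (Fin k) r → Vec A r → Vec A k
v ⟨ [] , [] ⟩ = v
v ⟨ i ∷ is , u ∷ us ⟩ = (v [ i ]≔ u) ⟨ is , us ⟩

-- pr_t for 1 ≤ t ≤ k, written with t = suc t', k = suc t' + m
pr : ∀ {n} t m → LP (Tup n (suc t + m)) → LP (Tup n (suc t))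
pr t m γ = record { Lab = Lab γ ; lab = λ w → lab γ (w ++ replicate m (last w)) }

Graph : ℕ → Set₁
Graph n = LP (Tup n 2)

atomic : ∀ {n} k → Graph n → LP (Tup n k)
atomic k Γ = record
  { Lab = Fam (Inj k 2) (Lab Γ)
  ; lab = λ v ij → lab Γ (lookup v (lookup (proj₁ ij) fzero)
                         ∷ lookup v (lookup (proj₁ ij) (fsuc fzero)) ∷ []) }

-- Refinement operators (the operators below satisfy γ ⪯ R∘γ)

RefOp : ℕ → Set₁
RefOp k = ∀ n → LP (Tup n k) → LP (Tup n k)

iter : ∀ {k n} → RefOp k → LP (Tup n k) → ℕ → LP (Tup n k)
iter R γ zero = γ
iter {n = n} R γ (suc i) = R n (iter R γ i)

Stable : ∀ {k n} → RefOp k → LP (Tup n k) → Set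
Stable {n = n} R γ = γ ≈P R n γ

FirstStable : ∀ {k n} → RefOp k → LP (Tup n k) → ℕ → Set
FirstStable R γ i = Stable R (iter R γ i) × (∀ j → suc j ≤ i → ¬ Stable R (iter R γ j))

WL : ∀ k r → RefOp k
WL k r n γ with k ≤? r
... | yes _ = γ
... | no  _ = record
  { Lab = ×-setoid (Lab γ) (MSet (Tup n r) (Fam (Inj k r) (Lab γ)))
  ; lab = λ v → lab γ v , λ x ι → lab γ (v ⟨ proj₁ ι , x ⟩) }

C : ∀ k r → RefOp k
C k r n γ with k ≤? r
... | yes _ = γ
... | no  _ = record
  { Lab = ×-setoid (Lab γ) (Fam (Inj k r) (MSet (Tup n r) (Lab γ)))
  ; lab = λ v → lab γ v , λ ι x → lab γ (v ⟨ proj₁ ι , x ⟩) }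

Family : Set₁
Family = (k : ℕ) → RefOp k

-- \bar R_k(Γ) for k = suc k′.  Since [α]^R is "the first stable term",
-- we describe the value through the iteration index j it is reached at:
-- schemeOK R k Γ j  says j is admissible, schemeVal R k Γ j is the value.
schemeOK : Family → ∀ {n} (k′ : ℕ) → Graph n → ℕ → Set
schemeOK R zero Γ j = ⊤
schemeOK R (suc m) Γ j = FirstStable (R (suc (suc m))) (atomic (suc (suc m)) Γ) j

schemeVal : Family → ∀ {n} (k′ : ℕ) → Graph n → ℕ → Graph n
schemeVal R zero Γ j = Γ
schemeVal R (suc m) Γ j = pr 1 m (iter (R (suc (suc m))) (atomic (suc (suc m)) Γ) j)

-- S_Y ⪯ S_X  (S_X dominates S_Y): for every k there is k′ such that
-- Y_k(Γ) ⪯ X_k′(Γ) for all graphs Γ (indices k = suc k₀ ≥ 1).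
_⪯S_ : Family → Family → Set₁
Y ⪯S X = ∀ k₀ → ∃ λ k₀′ → ∀ n (Γ : Graph n) i j →
           schemeOK Y k₀ Γ i → schemeOK X k₀′ Γ j →
           schemeVal Y k₀ Γ i ⪯ schemeVal X k₀′ Γ j

_≃S_ : Family → Family → Set₁
X ≃S Y = (X ⪯S Y) × (Y ⪯S X)

𝐖𝐋 : ℕ → Family
𝐖𝐋 r k = WL k r

𝐂 : ℕ → Family
𝐂 r k = C k r

{-# OPTIONS --safe #-}

-- Let ρ be a stable term of either scheme X (arity r, dimension K), and let γ be an iterate of
-- either scheme Y (arity s, dimension k), with K ≥ 2 + s + k + r.  By induction on the iteration,
-- ρ u = ρ u' implies γ (u ∘ f) = γ (u' ∘ f) for *every* coordinate map f : [k] → [K]; applied to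
-- f = (1,2,2,…,2) this is the domination of Y by X.
--
-- Inductive step: r coordinates of K lie outside the image of f, so stability of ρ gives a
-- bijection of V^r matching the extensions of u and u' there.  Only the first new coordinate is
-- looked at, so each colour is counted n^(r-1) times on both sides, and dividing by n^(r-1) gives
-- a bijection of V.  Doing this s times gives the bijection of V^s that Y asks for.
--
-- Base case: atomic types do not record the loops Γ(v,v).  If ρ u = ρ u', put a copy of u_j in a
-- free coordinate of u and let x be its partner in u'.  A further extension shows that x and u'_j
-- have the same out-neighbourhoods in Γ, hence Γ(u_j,u_j) = Γ(x,u'_j) = Γ(u'_j,u'_j).
--
-- Label equality is undecidable, so a stable term need not exist constructively and domination
-- cannot be composed; every pair of schemes is therefore treated directly.

module Submission where

open import Defs
open import Level using (0ℓ)
open import Data.Bool.Base using (if_then_else_)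
open import Data.Empty using (⊥-elim)
open import Data.Nat using (ℕ; zero; suc; _+_; _*_; _^_; _≤_; _≤?_; s≤s; NonZero)
open import Data.Nat.Properties using (+-0-commutativeMonoid; +-assoc; +-cancelˡ-≡; +-suc; *-cancelˡ-≡; *-distribˡ-+; *-zeroʳ; m^n≢0; ≤-trans; ≤-refl; ≤-reflexive; m≤n+m; 1+n≰n)
open import Data.Fin using (Fin; inject≤; punchIn; remQuot; combine; quotient; _↑ˡ_; _↑ʳ_) renaming (zero to fzero; suc to fsuc)
open import Data.Fin.Permutation using (Permutation′; _⟨$⟩ʳ_; insert; insert-punchIn)
import Data.Fin.Permutation as Perm
open import Data.Fin.Properties using (_≟_; any?; inject≤-injective; punchIn-injective; punchInᵢ≢i; suc-injective; 0≢1+n; combine-remQuot; remQuot-combine; splitAt-↑ˡ; splitAt-↑ʳ)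
open import Data.Product using (Σ; _×_; _,_; proj₁; proj₂)
open import Data.Sum using (_⊎_; inj₁; inj₂; [_,_]′)
import Data.Sum.Properties as Sum
open import Data.Vec using (Vec; []; _∷_; head; lookup; map; replicate; tabulate; _[_]≔_)
open import Data.Vec.Properties using (lookup∘update; lookup∘update′; lookup∘tabulate; lookup-map; map-[]≔; map-replicate)
open import Function using (_∘_)
open import Function.Bundles using (_↔_; Inverse; mk↔ₛ′)
open import Function.Properties.Inverse using (↔-refl; ↔-sym; ↔-trans)
open import Relation.Binary using (Setoid; DecidableEquality)
open import Relation.Binary.PropositionalEquality using (_≡_; _≢_; refl; sym; trans; cong; cong₂; subst₂; module ≡-Reasoning)
open import Relation.Nullary using (¬_; yes; no; does; contradiction)

open import Algebra.Properties.CommutativeMonoid.Sum +-0-commutativeMonoid using (sum; sum-cong-≗; sum-remove; sum-permute; sum-replicate-zero)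

-- Division of multisets

sum-+ : ∀ m {n} (f : Fin (m + n) → ℕ) →
        sum f ≡ sum (λ i → f (i ↑ˡ n)) + sum (λ j → f (m ↑ʳ j))
sum-+ zero    f = refl
sum-+ (suc m) f = trans (cong (f fzero +_) (sum-+ m (f ∘ fsuc))) (sym (+-assoc (f fzero) _ _))

sum-const : ∀ m c → sum {m} (λ _ → c) ≡ m * c
sum-const zero    c = refl
sum-const (suc m) c = cong (c +_) (sum-const m c)

-- Every quotient is attained by exactly `n` indices; this is the multiplicity that `MSet-head`
-- divides out.
sum-quotient : ∀ {m} n (f : Fin m → ℕ) → sum {m * n} (λ i → f (quotient n i)) ≡ n * sum f
sum-quotient {zero}  n f = sym (*-zeroʳ n)
sum-quotient {suc m} n f = begin
  sum (λ i → f (quotient n i))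
    ≡⟨ sum-+ n (λ i → f (quotient n i)) ⟩
  sum (λ i → f (quotient {suc m} n (i ↑ˡ m * n))) + sum (λ j → f (quotient {suc m} n (n ↑ʳ j)))
    ≡⟨ cong₂ _+_ (sum-cong-≗ (cong f ∘ left)) (sum-cong-≗ (cong f ∘ right)) ⟩
  sum {n} (λ _ → f fzero) + sum {m * n} (λ j → f (fsuc (quotient n j)))
    ≡⟨ cong₂ _+_ (sum-const n (f fzero)) (sum-quotient n (f ∘ fsuc)) ⟩
  n * f fzero + n * sum (f ∘ fsuc)
    ≡⟨ *-distribˡ-+ n (f fzero) _ ⟨
  n * sum f ∎
  where
  open ≡-Reasoning
  left : ∀ i → quotient {suc m} n (i ↑ˡ m * n) ≡ fzero
  left i rewrite splitAt-↑ˡ n i (m * n) = refl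
  right : ∀ j → quotient {suc m} n (n ↑ʳ j) ≡ fsuc (quotient n j)
  right j rewrite splitAt-↑ʳ n (m * n) j = refl

module _ {D : Set} (_≟D_ : DecidableEquality D) where

  indicator : D → D → ℕ
  indicator z y = if does (y ≟D z) then 1 else 0

  count : ∀ {n} → D → (Fin n → D) → ℕ
  count z a = sum (indicator z ∘ a)

  indicator-≡ : ∀ {z y} → y ≡ z → indicator z y ≡ 1
  indicator-≡ {z} {y} eq with y ≟D z
  ... | yes _ = refl
  ... | no ≢  = contradiction eq ≢

  indicator-≢ : ∀ {z y} → y ≢ z → indicator z y ≡ 0
  indicator-≢ {z} {y} ne with y ≟D z
  ... | yes eq = contradiction eq ne
  ... | no _   = refl

  count-∉ : ∀ {n} z (a : Fin n → D) → (∀ i → a i ≢ z) → count z a ≡ 0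
  count-∉ {n} z a ne = trans (sum-cong-≗ (λ i → indicator-≢ (ne i))) (sum-replicate-zero n)

  -- Greedy matching: `a fzero` is paired with some equal `b j`, and deleting both keeps all counts
  -- equal.
  count≡⇒permutation : ∀ {n} (a b : Fin n → D) → (∀ z → count z a ≡ count z b) →
                       Σ (Permutation′ n) λ π → ∀ i → a i ≡ b (π ⟨$⟩ʳ i)
  count≡⇒permutation {zero}  a b eq = Perm.id , λ ()
  count≡⇒permutation {suc n} a b eq with any? (λ j → b j ≟D a fzero)
  ... | no ∄j = ⊥-elim (1≢0 (trans (eq (a fzero)) (count-∉ (a fzero) b (λ j e → ∄j (j , e)))))
    where
    1≢0 : count (a fzero) a ≢ 0
    1≢0 rewrite indicator-≡ {a fzero} refl = λ ()
  ... | yes (j , bj≡a0) = insert fzero j π , matches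
    where
    counts-tail : ∀ z → count z (a ∘ fsuc) ≡ count z (b ∘ punchIn j)
    counts-tail z = +-cancelˡ-≡ (indicator z (a fzero)) _ _
      (trans (eq z) (trans (sum-remove {i = j} (indicator z ∘ b))
                           (cong (λ y → indicator z y + count z (b ∘ punchIn j)) bj≡a0)))
    ih = count≡⇒permutation (a ∘ fsuc) (b ∘ punchIn j) counts-tail
    π = proj₁ ih
    matches : ∀ i → a i ≡ b (insert fzero j π ⟨$⟩ʳ i)
    matches fzero    = sym bj≡a0
    matches (fsuc i) = trans (proj₂ ih i) (cong b (sym (insert-punchIn fzero j π i)))

-- Finitely many equations between labels factor the labelling through decidable representatives.
representatives : (S : Setoid 0ℓ 0ℓ) → let open Setoid S in {I : Set} (_≟I_ : DecidableEquality I)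
  (v : I → Carrier) {m : ℕ} (l r : Fin m → I) → (∀ e → v (l e) ≈ v (r e)) →
  Σ (I → I) λ c → (∀ i → v i ≈ v (c i)) × (∀ e → c (l e) ≡ c (r e))
representatives S _≟I_ v {zero} l r eqs = (λ i → i) , (λ i → Setoid.refl S) , λ ()
representatives S {I} _≟I_ v {suc m} l r eqs =
  merge ∘ c , (λ i → S.trans (sound i) (merge-sound (c i))) , merged
  where
  module S = Setoid S
  rec = representatives S _≟I_ v (l ∘ fsuc) (r ∘ fsuc) (eqs ∘ fsuc)
  c = proj₁ rec
  sound = proj₁ (proj₂ rec)
  p = c (l fzero)
  q = c (r fzero)
  merge : I → I
  merge y = if does (y ≟I q) then p else y
  q≈p : v q S.≈ v p
  q≈p = S.trans (S.sym (sound (r fzero))) (S.trans (S.sym (eqs fzero)) (sound (l fzero)))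
  merge-sound : ∀ y → v y S.≈ v (merge y)
  merge-sound y with y ≟I q
  ... | yes refl = q≈p
  ... | no _     = S.refl
  merge-p : merge p ≡ p
  merge-p with p ≟I q
  ... | yes _ = refl
  ... | no _  = refl
  merge-q : merge q ≡ p
  merge-q with q ≟I q
  ... | yes _ = refl
  ... | no ≢  = contradiction refl ≢
  merged : ∀ e → merge (c (l e)) ≡ merge (c (r e))
  merged fzero    = trans merge-p (sym merge-q)
  merged (fsuc e) = cong merge (proj₂ (proj₂ rec) e)

-- The head of a decoded vector computes to a quotient by `n ^ r`, so `sum-quotient` applies to
-- labels depending only on the head.
Vec↔Fin^ : ∀ n r → Vec (Fin n) r ↔ Fin (n ^ r)
Vec↔Fin^ n zero    = mk↔ₛ′ (λ _ → fzero) (λ _ → []) (λ { fzero → refl ; (fsuc ()) }) (λ { [] → refl })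
Vec↔Fin^ n (suc r) = mk↔ₛ′
  (λ { (y ∷ ys) → combine y (to ys) })
  (λ i → quotient (n ^ r) i ∷ from (proj₂ (remQuot {n} (n ^ r) i)))
  (λ i → trans (cong (combine (quotient {n} (n ^ r) i)) (strictlyInverseˡ _))
               (combine-remQuot {n} (n ^ r) i))
  (λ { (y ∷ ys) → trans (cong (λ p → proj₁ p ∷ from (proj₂ p)) (remQuot-combine y (to ys)))
                        (cong (y ∷_) (strictlyInverseʳ ys)) })
  where open Inverse (Vec↔Fin^ n r)

-- The given bijection need not respect heads, so colours are counted instead, after passing to
-- representatives, whose equality is decidable.
MSet-head : ∀ (S : Setoid 0ℓ 0ℓ) {n r} (ℓ ℓ′ : Fin n → Setoid.Carrier S) →
  Setoid._≈_ (MSet (Vec (Fin n) (suc r)) S) (ℓ ∘ head) (ℓ′ ∘ head) →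
  Setoid._≈_ (MSet (Fin n) S) ℓ ℓ′
-- Here `n ^ r` may be zero and could not be cancelled; `Fin zero` is empty.
MSet-head S {zero}      ℓ ℓ′ _ = ↔-refl , λ ()
MSet-head S {n@(suc _)} {r} ℓ ℓ′ (τ , eqs) =
  proj₁ perm , λ i → S.trans (sound (inj₁ i))
    (S.trans (S.reflexive (cong v (proj₂ perm i))) (S.sym (sound (inj₂ _))))
  where
  module S = Setoid S
  I = Fin n ⊎ Fin n
  N = n ^ r
  instance
    N≢0 : NonZero N
    N≢0 = m^n≢0 n r
  _≟I_ : DecidableEquality I
  _≟I_ = Sum.≡-dec _≟_ _≟_
  -- One choice of representatives on the disjoint sum makes the colours of both families
  -- comparable.
  v : I → S.Carrier
  v = [ ℓ , ℓ′ ]′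
  π : Permutation′ (n * N)
  π = ↔-trans (↔-sym (Vec↔Fin^ n (suc r))) (↔-trans τ (Vec↔Fin^ n (suc r)))
  decode : Fin (n * N) → Vec (Fin n) (suc r)
  decode = Inverse.from (Vec↔Fin^ n (suc r))
  equations : ∀ e → ℓ (quotient N e) S.≈ ℓ′ (quotient N (π ⟨$⟩ʳ e))
  equations e = S.trans (eqs (decode e))
    (S.reflexive (cong (ℓ′ ∘ head)
      (sym (Inverse.strictlyInverseʳ (Vec↔Fin^ n (suc r)) (Inverse.to τ (decode e))))))
  reps = representatives S _≟I_ v
           (λ e → inj₁ (quotient N e)) (λ e → inj₂ (quotient N (π ⟨$⟩ʳ e))) equations
  c = proj₁ reps
  sound = proj₁ (proj₂ reps)
  counts : ∀ z → count _≟I_ z (c ∘ inj₁) ≡ count _≟I_ z (c ∘ inj₂)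
  counts z = *-cancelˡ-≡ _ _ N (begin
    N * sum (χ ∘ inj₁)                               ≡⟨ sum-quotient N (χ ∘ inj₁) ⟨
    sum (λ e → χ (inj₁ (quotient N e)))              ≡⟨ sum-cong-≗ (cong (indicator _≟I_ z) ∘ proj₂ (proj₂ reps)) ⟩
    sum (λ e → χ (inj₂ (quotient N (π ⟨$⟩ʳ e))))     ≡⟨ sum-permute (λ e → χ (inj₂ (quotient N e))) π ⟨
    sum (λ e → χ (inj₂ (quotient N e)))              ≡⟨ sum-quotient N (χ ∘ inj₂) ⟩
    N * sum (χ ∘ inj₂)                               ∎)
    where
    open ≡-Reasoning
    χ : I → ℕ
    χ = indicator _≟I_ z ∘ c
  perm = count≡⇒permutation _≟I_ (c ∘ inj₁) (c ∘ inj₂) counts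

-- The bijection of tails depends on the head, so the inverse must recover the head through `β.from`
-- first.
MSet-∷ : ∀ (S : Setoid 0ℓ 0ℓ) {A : Set} {s} {g g′ : Vec A (suc s) → Setoid.Carrier S} →
  Setoid._≈_ (MSet A (MSet (Vec A s) S)) (λ y z → g (y ∷ z)) (λ y z → g′ (y ∷ z)) →
  Setoid._≈_ (MSet (Vec A (suc s)) S) g g′
MSet-∷ S {A} {s} (β , p) = mk↔ₛ′ to from to-from from-to , λ { (y ∷ z) → proj₂ (p y) z }
  where
  module β = Inverse β
  σ : A → Vec A s ↔ Vec A s
  σ y = proj₁ (p y)
  to from : Vec A (suc s) → Vec A (suc s)
  to   (y ∷ z) = β.to y ∷ Inverse.to (σ y) z
  from (y ∷ z) = β.from y ∷ Inverse.from (σ (β.from y)) z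
  to-from : ∀ w → to (from w) ≡ w
  to-from (y ∷ z) = cong₂ _∷_ (β.strictlyInverseˡ y) (Inverse.strictlyInverseˡ (σ (β.from y)) z)
  -- The recovered head is generalised to `y₁`, so that `σ y₁` changes along with it.
  from-to′ : ∀ {y y₁} → y₁ ≡ y → ∀ z → y₁ ∷ Inverse.from (σ y₁) (Inverse.to (σ y) z) ≡ y ∷ z
  from-to′ {y} refl z = cong (y ∷_) (Inverse.strictlyInverseʳ (σ y) z)
  from-to : ∀ w → from (to w) ≡ w
  from-to (y ∷ z) = from-to′ (β.strictlyInverseʳ y) z

-- Coordinates

lookup-⟨⟩-∉ : ∀ {A : Set} {k r} (v : Vec A k) (is : Vec (Fin k) r) (xs : Vec A r) {j} →
  (∀ a → lookup is a ≢ j) → lookup (v ⟨ is , xs ⟩) j ≡ lookup v j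
lookup-⟨⟩-∉ v []       []       ∉ = refl
lookup-⟨⟩-∉ v (i ∷ is) (x ∷ xs) ∉ =
  trans (lookup-⟨⟩-∉ (v [ i ]≔ x) is xs (∉ ∘ fsuc)) (lookup∘update′ (∉ fzero ∘ sym) v x)

Injective-lookup : ∀ {k r} → Vec (Fin k) r → Set
Injective-lookup is = ∀ a b → lookup is a ≡ lookup is b → a ≡ b

lookup-⟨⟩-head : ∀ {A : Set} {k r} (v : Vec A k) i (is : Vec (Fin k) r) (xs : Vec A (suc r)) →
  Injective-lookup (i ∷ is) → lookup (v ⟨ i ∷ is , xs ⟩) i ≡ head xs
lookup-⟨⟩-head v i is (x ∷ xs) inj =
  trans (lookup-⟨⟩-∉ (v [ i ]≔ x) is xs (λ a eq → 0≢1+n (inj fzero (fsuc a) (sym eq))))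
        (lookup∘update i v x)

map-⟨⟩ : ∀ {A B : Set} (φ : A → B) {k r} (v : Vec A k) (is : Vec (Fin k) r) (xs : Vec A r) →
  map φ (v ⟨ is , xs ⟩) ≡ map φ v ⟨ is , map φ xs ⟩
map-⟨⟩ φ v []       []       = refl
map-⟨⟩ φ v (i ∷ is) (x ∷ xs) =
  trans (map-⟨⟩ φ (v [ i ]≔ x) is xs) (cong (_⟨ is , map φ xs ⟩) (map-[]≔ φ v i))

_∘ᵛ_ : ∀ {A : Set} {K k} → Vec A K → Vec (Fin K) k → Vec A k
u ∘ᵛ f = map (lookup u) f

⟨⟩-∘ᵛ : ∀ {A : Set} {K r t} (u : Vec A K) (is : Vec (Fin K) r) (xs : Vec A r) (f : Vec (Fin K) t) →
  (∀ a b → lookup is a ≢ lookup f b) → (u ⟨ is , xs ⟩) ∘ᵛ f ≡ u ∘ᵛ f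
⟨⟩-∘ᵛ u is xs []      ∉ = refl
⟨⟩-∘ᵛ u is xs (j ∷ f) ∉ =
  cong₂ _∷_ (lookup-⟨⟩-∉ u is xs (λ a → ∉ a fzero)) (⟨⟩-∘ᵛ u is xs f (λ a b → ∉ a (fsuc b)))

Injectiveᶠ : ∀ {m n} → (Fin m → Fin n) → Set
Injectiveᶠ q = ∀ a b → q a ≡ q b → a ≡ b

-- By injectivity at most one index hits `j`; that index is dropped, or `fzero` if there is none.
avoid-one : ∀ {m K} (q : Fin (suc m) → Fin K) → Injectiveᶠ q → ∀ j →
  Σ (Fin m → Fin (suc m)) λ e → Injectiveᶠ e × (∀ a → q (e a) ≢ j)
avoid-one q inj j with any? (λ a → q a ≟ j)
... | yes (a , eq) = punchIn a , punchIn-injective a ,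
                     λ b eq′ → punchInᵢ≢i a b (inj _ _ (trans eq′ (sym eq)))
... | no ∄a        = fsuc , (λ _ _ → suc-injective) , λ b eq → ∄a (fsuc b , eq)

avoid : ∀ {t m K} (q : Fin (t + m) → Fin K) → Injectiveᶠ q → (f : Vec (Fin K) t) →
  Σ (Fin m → Fin (t + m)) λ e → Injectiveᶠ e × (∀ a b → q (e a) ≢ lookup f b)
avoid q inj []      = (λ a → a) , (λ _ _ eq → eq) , λ _ ()
avoid q inj (j ∷ f) with avoid-one q inj j
... | e₁ , e₁-inj , ∉₁ with avoid (q ∘ e₁) (λ a b → e₁-inj a b ∘ inj _ _) f
... | e₂ , e₂-inj , ∉₂ = e₁ ∘ e₂ , (λ a b → e₂-inj a b ∘ e₁-inj _ _) ,
                       λ { a fzero → ∉₁ (e₂ a) ; a (fsuc b) → ∉₂ a b }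

free-coordinates : ∀ {t m K} → t + m ≤ K → (f : Vec (Fin K) t) →
  Σ (Inj K m) λ ι → ∀ a b → lookup (proj₁ ι) a ≢ lookup f b
free-coordinates {t} {m} {K} t+m≤K f =
  (tabulate p , λ a b eq → p-injective a b (trans (sym (lookup∘tabulate p a)) (trans eq (lookup∘tabulate p b)))) ,
  λ a b eq → ∉ a b (trans (sym (lookup∘tabulate p a)) eq)
  where
  q : Fin (t + m) → Fin K
  q a = inject≤ a t+m≤K
  q-injective : Injectiveᶠ q
  q-injective a b = inject≤-injective t+m≤K t+m≤K a b
  av = avoid q q-injective f
  ∉ = proj₂ (proj₂ av)
  p : Fin m → Fin K
  p = q ∘ proj₁ av
  p-injective : Injectiveᶠ p
  p-injective a b = proj₁ (proj₂ av) a b ∘ q-injective _ _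

-- Stable partitions

-- The common consequence of stability under both operators: `τ` may depend on `ι`, as it does for
-- `C`.
Extends : ∀ {n K} → ℕ → LP (Tup n K) → Set
Extends {n} {K} r ρ = ∀ (ι : Inj K r) u u′ → Same ρ u u′ →
  Σ (Tup n r ↔ Tup n r) λ τ → ∀ x → Same ρ (u ⟨ proj₁ ι , x ⟩) (u′ ⟨ proj₁ ι , Inverse.to τ x ⟩)

module _ {n K r₀} (ρ : LP (Tup n K)) (ext : Extends (suc r₀) ρ) where

  private r = suc r₀

  -- The first argument of `H` holds the entries that `extend` lets range over all of `V^s`.
  Invariant : (S : Setoid 0ℓ 0ℓ) → ∀ {s t} → (Tup n s → Tup n t → Setoid.Carrier S) → Set
  Invariant S {s} {t} H = ∀ u u′ → Same ρ u u′ → (g : Vec (Fin K) s) (f : Vec (Fin K) t) →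
    Setoid._≈_ S (H (u ∘ᵛ g) (u ∘ᵛ f)) (H (u′ ∘ᵛ g) (u′ ∘ᵛ f))

  -- Each new entry is realised at a coordinate outside `f`. The recursion keeps `s + t` constant,
  -- so `r` free coordinates remain at every stage.
  extend : (S : Setoid 0ℓ 0ℓ) → ∀ s {t} → s + (t + r) ≤ K →
    (H : Tup n s → Tup n t → Setoid.Carrier S) → Invariant S H →
    ∀ u u′ → Same ρ u u′ → (f : Vec (Fin K) t) →
    Setoid._≈_ (MSet (Tup n s) S) (λ x → H x (u ∘ᵛ f)) (λ x → H x (u′ ∘ᵛ f))
  extend S zero    _     H inv u u′ ρuu′ f = ↔-refl , λ { [] → inv u u′ ρuu′ [] f }
  extend S (suc s) {t} bound H inv u u′ ρuu′ f
    with free-coordinates (≤-trans (m≤n+m (t + r) (suc s)) bound) f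
  ... | (i ∷ is , inj) , ∉ =
    MSet-∷ S {g = λ x → H x (u ∘ᵛ f)} {g′ = λ x → H x (u′ ∘ᵛ f)}
      (MSet-head (MSet (Tup n s) S) (λ y z → H (y ∷ z) (u ∘ᵛ f)) (λ y z → H (y ∷ z) (u′ ∘ᵛ f))
        (τ , matches))
    where
    p = i ∷ is
    τ = proj₁ (ext (p , inj) u u′ ρuu′)
    -- The entry just chosen joins the fixed ones, so the recursion can run on the extended tuples
    -- with `i ∷ f`.
    H′ : Tup n s → Tup n (suc t) → Setoid.Carrier S
    H′ z (y ∷ w) = H (y ∷ z) w
    inv′ : Invariant S H′
    inv′ v v′ ρvv′ g (j ∷ h) = inv v v′ ρvv′ (j ∷ g) h
    coordinates : ∀ v x → (v ⟨ p , x ⟩) ∘ᵛ (i ∷ f) ≡ head x ∷ (v ∘ᵛ f)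
    coordinates v x = cong₂ _∷_ (lookup-⟨⟩-head v i is x inj) (⟨⟩-∘ᵛ v p x f ∉)
    matches : ∀ x → Setoid._≈_ (MSet (Tup n s) S)
      (λ z → H (head x ∷ z) (u ∘ᵛ f)) (λ z → H (head (Inverse.to τ x) ∷ z) (u′ ∘ᵛ f))
    matches x = subst₂ (λ w w′ → Setoid._≈_ (MSet (Tup n s) S) (λ z → H′ z w) (λ z → H′ z w′))
      (coordinates u x) (coordinates u′ (Inverse.to τ x))
      (extend S s (≤-trans (≤-reflexive (+-suc s (t + r))) bound) H′ inv′ _ _
        (proj₂ (ext (p , inj) u u′ ρuu′) x) (i ∷ f))

  -- Edges, loops and atomic types

  module _ (Γ : Graph n) (α⪯ρ : atomic K Γ ⪯ ρ) (bound : 2 + r ≤ K) where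

    private
      module L = Setoid (Lab Γ)

    edge : Fin n → Fin n → L.Carrier
    edge x y = lab Γ (x ∷ y ∷ [])

    edge-≢ : ∀ u u′ → Same ρ u u′ → ∀ {a b} → a ≢ b →
      edge (lookup u a) (lookup u b) L.≈ edge (lookup u′ a) (lookup u′ b)
    edge-≢ u u′ ρuu′ {a} {b} a≢b = α⪯ρ u u′ ρuu′ (a ∷ b ∷ [] ,
      λ { fzero fzero _ → refl ; fzero (fsuc fzero) eq → contradiction eq a≢b
        ; (fsuc fzero) fzero eq → contradiction (sym eq) a≢b ; (fsuc fzero) (fsuc fzero) _ → refl })

    -- The entries of `u′` at `i` and `j` may differ, but edges from both to a fresh coordinate are
    -- recorded by the atomic type.
    edge-twin : ∀ u u′ → Same ρ u u′ → ∀ i j → lookup u i ≡ lookup u j → ∀ z →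
      edge (lookup u′ i) z L.≈ edge (lookup u′ j) z
    edge-twin u u′ ρuu′ i j ui≡uj z with free-coordinates bound (i ∷ j ∷ [])
    ... | (q ∷ qs , inj) , ∉ =
      L.trans (L.sym (row i (λ a → ∉ a fzero)))
        (L.trans (L.reflexive (cong (λ a → edge a (head x)) ui≡uj)) (row j (λ a → ∉ a (fsuc fzero))))
      where
      p = q ∷ qs
      ex = ext (p , inj) u u′ ρuu′
      τ = proj₁ ex
      -- Since `z` is arbitrary, the extension is chosen backwards: `τ` sends `x` to the constant
      -- tuple of `z`.
      x = Inverse.from τ (replicate r z)
      x′ = Inverse.to τ x
      x′≡z : head x′ ≡ z
      x′≡z = cong head (Inverse.strictlyInverseˡ τ (replicate r z))
      row : ∀ a → (∀ c → lookup p c ≢ a) →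
        edge (lookup u a) (head x) L.≈ edge (lookup u′ a) z
      row a ∉a = subst₂ L._≈_
        (cong₂ edge (lookup-⟨⟩-∉ u p x ∉a) (lookup-⟨⟩-head u q qs x inj))
        (cong₂ edge (lookup-⟨⟩-∉ u′ p x′ ∉a) (trans (lookup-⟨⟩-head u′ q qs x′ inj) x′≡z))
        (edge-≢ _ _ (proj₂ ex x) (λ eq → ∉a fzero (sym eq)))

    edge-loop : ∀ u u′ → Same ρ u u′ → ∀ j →
      edge (lookup u j) (lookup u j) L.≈ edge (lookup u′ j) (lookup u′ j)
    edge-loop u u′ ρuu′ j with free-coordinates (≤-trans (m≤n+m (1 + r) 1) bound) (j ∷ [])
    ... | (i ∷ is , inj) , ∉ =
      -- The loop is read in `v` as the edge between the distinct coordinates `i` and `j`, carried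
      -- to `v′`, and closed up again by `edge-twin`.
      L.trans (L.trans (L.reflexive (sym (cong₂ edge vi vj))) (edge-≢ v v′ ρvv′ (∉ fzero fzero)))
        (L.trans (edge-twin v v′ ρvv′ i j (trans vi (sym vj)) (lookup v′ j))
                 (L.reflexive (cong₂ edge v′j v′j)))
      where
      p = i ∷ is
      ex = ext (p , inj) u u′ ρuu′
      x = replicate r (lookup u j)
      x′ = Inverse.to (proj₁ ex) x
      v = u ⟨ p , x ⟩
      v′ = u′ ⟨ p , x′ ⟩
      ρvv′ : Same ρ v v′
      ρvv′ = proj₂ ex x
      vi : lookup v i ≡ lookup u j
      vi = lookup-⟨⟩-head u i is x inj
      vj : lookup v j ≡ lookup u j
      vj = lookup-⟨⟩-∉ u p x (λ a → ∉ a fzero)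
      v′j : lookup v′ j ≡ lookup u′ j
      v′j = lookup-⟨⟩-∉ u′ p x′ (λ a → ∉ a fzero)

    edge-invariant : ∀ u u′ → Same ρ u u′ → ∀ a b →
      edge (lookup u a) (lookup u b) L.≈ edge (lookup u′ a) (lookup u′ b)
    edge-invariant u u′ ρuu′ a b with a ≟ b
    ... | yes refl = edge-loop u u′ ρuu′ a
    ... | no a≢b   = edge-≢ u u′ ρuu′ a≢b

    atomic-invariant : ∀ {k} (f : Vec (Fin K) k) u u′ → Same ρ u u′ →
      Same (atomic k Γ) (u ∘ᵛ f) (u′ ∘ᵛ f)
    atomic-invariant f u u′ ρuu′ (is , _) = subst₂ L._≈_
      (sym (cong₂ edge (lookup-map (lookup is fzero) (lookup u) f) (lookup-map (lookup is (fsuc fzero)) (lookup u) f)))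
      (sym (cong₂ edge (lookup-map (lookup is fzero) (lookup u′) f) (lookup-map (lookup is (fsuc fzero)) (lookup u′) f)))
      (edge-invariant u u′ ρuu′ _ _)

-- The two operators

-- The condition on the dominated family: a round is no finer than `γ` with the WL multiset, the
-- finer of the two kinds of data.
BoundedBy : ∀ {k} → ℕ → RefOp k → Set₁
BoundedBy {k} s R = ∀ {n} (γ : LP (Tup n k)) v v′ → Same γ v v′ →
  Setoid._≈_ (MSet (Tup n s) (Fam (Inj k s) (Lab γ)))
    (λ x ι → lab γ (v ⟨ proj₁ ι , x ⟩)) (λ x ι → lab γ (v′ ⟨ proj₁ ι , x ⟩)) →
  Same (R n γ) v v′

record Refines {k} (r : ℕ) (R : RefOp k) : Set₁ where
  field
    inflationary : ∀ {n} (γ : LP (Tup n k)) → γ ⪯ R n γ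
    stable⇒extends : ∀ {n} (γ : LP (Tup n k)) → Stable R γ → Extends r γ

WL-boundedBy : ∀ k s → BoundedBy s (WL k s)
WL-boundedBy k s γ v v′ eq ms with k ≤? s
... | yes _ = eq
... | no _  = eq , ms

-- A single bijection matching the whole families serves every `ι`.
C-boundedBy : ∀ k s → BoundedBy s (C k s)
C-boundedBy k s γ v v′ eq (σ , ms) with k ≤? s
... | yes _ = eq
... | no _  = eq , λ ι → σ , λ x → ms x ι

-- For `k ≤ r` the operator is the identity and stability would carry no information.
WL-refines : ∀ {k r} → ¬ (k ≤ r) → Refines r (WL k r)
WL-refines {k} {r} k≰r = record { inflationary = infl ; stable⇒extends = ext }
  where
  infl : ∀ {n} (γ : LP (Tup n k)) → γ ⪯ WL k r n γ
  infl γ v v′ eq with k ≤? r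
  ... | yes _ = eq
  ... | no _  = proj₁ eq
  ext : ∀ {n} (γ : LP (Tup n k)) → Stable (WL k r) γ → Extends r γ
  ext γ st with k ≤? r
  ... | yes k≤r = contradiction k≤r k≰r
  ... | no _    = λ ι v v′ eq → let (_ , σ , ms) = proj₂ st v v′ eq in σ , λ x → ms x ι

C-refines : ∀ {k r} → ¬ (k ≤ r) → Refines r (C k r)
C-refines {k} {r} k≰r = record { inflationary = infl ; stable⇒extends = ext }
  where
  infl : ∀ {n} (γ : LP (Tup n k)) → γ ⪯ C k r n γ
  infl γ v v′ eq with k ≤? r
  ... | yes _ = eq
  ... | no _  = proj₁ eq
  ext : ∀ {n} (γ : LP (Tup n k)) → Stable (C k r) γ → Extends r γ
  ext γ st with k ≤? r
  ... | yes k≤r = contradiction k≤r k≰r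
  ... | no _    = λ ι v v′ eq → proj₂ (proj₂ st v v′ eq) ι

-- Iterates under a stable partition

iter-inflationary : ∀ {k n r} {R : RefOp k} → Refines r R → ∀ (γ : LP (Tup n k)) i → γ ⪯ iter R γ i
iter-inflationary ref γ zero    v v′ eq = eq
iter-inflationary ref γ (suc i) v v′ eq =
  iter-inflationary ref γ i v v′ (Refines.inflationary ref _ v v′ eq)

-- The induction ranges over all `f`, injective or not, because substituting coordinates `g` into
-- `h` at `ι` gives another coordinate map.
iter-invariant : ∀ {k s r₀ n K} {R : RefOp k} → BoundedBy s R →
  (α : LP (Tup n k)) (ρ : LP (Tup n K)) → Extends (suc r₀) ρ → s + (k + suc r₀) ≤ K →
  ((f : Vec (Fin K) k) → ∀ u u′ → Same ρ u u′ → Same α (u ∘ᵛ f) (u′ ∘ᵛ f)) →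
  ∀ i (f : Vec (Fin K) k) u u′ → Same ρ u u′ → Same (iter R α i) (u ∘ᵛ f) (u′ ∘ᵛ f)
iter-invariant bb α ρ ext bound base zero = base
iter-invariant {k} {s} {n = n} {K} {R} bb α ρ ext bound base (suc i) f u u′ ρuu′ =
  bb γ _ _ (ih f u u′ ρuu′) (extend ρ ext (Fam (Inj k s) (Lab γ)) s bound H inv u u′ ρuu′ f)
  where
  γ = iter R α i
  ih = iter-invariant {R = R} bb α ρ ext bound base i
  H : Tup n s → Tup n k → Inj k s → Setoid.Carrier (Lab γ)
  H x w ι = lab γ (w ⟨ proj₁ ι , x ⟩)
  inv : Invariant ρ ext (Fam (Inj k s) (Lab γ)) H
  inv v v′ ρvv′ g h ι = subst₂ (Same γ)
    (map-⟨⟩ (lookup v) h (proj₁ ι) g) (map-⟨⟩ (lookup v′) h (proj₁ ι) g)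
    (ih (h ⟨ proj₁ ι , g ⟩) v v′ ρvv′)

-- Domination between schemes

module _ {s r₀ : ℕ} {Y X : Family} (Y-bounded : ∀ k → BoundedBy s (Y k))
         (X-refines : ∀ k → ¬ (k ≤ suc r₀) → Refines (suc r₀) (X k)) where

  scheme-bounded : ∀ k₀ m → s + (suc k₀ + suc r₀) ≤ m → ∀ {n} (Γ : Graph n) i j →
    schemeOK X (suc m) Γ j → schemeVal Y k₀ Γ i ⪯ schemeVal X (suc m) Γ j
  scheme-bounded k₀ m bound {n} Γ i j (stable , _) = go k₀ bound
    where
    K = 2 + m
    ρ = iter (X K) (atomic K Γ) j
    r≤m : suc r₀ ≤ m
    r≤m = ≤-trans (≤-trans (m≤n+m (suc r₀) (suc k₀)) (m≤n+m (suc k₀ + suc r₀) s)) bound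
    refK : Refines (suc r₀) (X K)
    refK = X-refines K λ K≤r → 1+n≰n (≤-trans (≤-trans (m≤n+m (suc m) 1) K≤r) r≤m)
    ext : Extends (suc r₀) ρ
    ext = Refines.stable⇒extends refK ρ stable
    α⪯ρ : atomic K Γ ⪯ ρ
    α⪯ρ = iter-inflationary refK (atomic K Γ) j
    2+r≤K : 2 + suc r₀ ≤ K
    2+r≤K = s≤s (s≤s r≤m)
    go : ∀ k₀ → s + (suc k₀ + suc r₀) ≤ m → schemeVal Y k₀ Γ i ⪯ schemeVal X (suc m) Γ j
    go zero    _     (a ∷ b ∷ []) (a′ ∷ b′ ∷ []) eq =
      edge-invariant ρ ext Γ α⪯ρ 2+r≤K _ _ eq fzero (fsuc fzero)
    go (suc l) bound (a ∷ b ∷ []) (a′ ∷ b′ ∷ []) eq =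
      subst₂ (Same (iter (Y k) (atomic k Γ) i)) (coordinates a b) (coordinates a′ b′)
        (iter-invariant {R = Y k} (Y-bounded k) (atomic k Γ) ρ ext (≤-trans bound (m≤n+m m 2))
          (atomic-invariant ρ ext Γ α⪯ρ 2+r≤K) i f _ _ eq)
      where
      k = 2 + l
      f : Vec (Fin K) k
      -- Composing the padded pair of length `K` with this map gives the padded pair of length `k`.
      f = fzero ∷ fsuc fzero ∷ replicate l (fsuc fzero)
      coordinates : ∀ a b → (a ∷ b ∷ replicate m b) ∘ᵛ f ≡ a ∷ b ∷ replicate l b
      coordinates a b =
        cong (λ w → a ∷ b ∷ w) (map-replicate (lookup (a ∷ b ∷ replicate m b)) (fsuc fzero) l)

  dominates : Y ⪯S X
  -- The index `suc m` means dimension `2 + m`; as `r ≤ m`, this also meets the bound `2 + r` used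
  -- for loops.
  dominates k₀ = suc m , λ n Γ i j _ ok → scheme-bounded k₀ m ≤-refl Γ i j ok
    where m = s + (suc k₀ + suc r₀)

theorem1 : (r₀ : ℕ) → let r = suc r₀ in
    (𝐖𝐋 1 ≃S 𝐂 1) × (𝐖𝐋 1 ≃S 𝐖𝐋 r) × (𝐖𝐋 1 ≃S 𝐂 r) ×
    (𝐂 1 ≃S 𝐖𝐋 r) × (𝐂 1 ≃S 𝐂 r) × (𝐖𝐋 r ≃S 𝐂 r)
theorem1 r₀ =
  -- The arguments are arities less one, so `0` stands for arity 1.
  (WL⪯C 0 0 , C⪯WL 0 0) , (WL⪯WL 0 r₀ , WL⪯WL r₀ 0) , (WL⪯C 0 r₀ , C⪯WL r₀ 0) ,
  (C⪯WL 0 r₀ , WL⪯C r₀ 0) , (C⪯C 0 r₀ , C⪯C r₀ 0) , (WL⪯C r₀ r₀ , C⪯WL r₀ r₀)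
  where
  WL⪯WL : ∀ s t → 𝐖𝐋 (suc s) ⪯S 𝐖𝐋 (suc t)
  WL⪯WL s t = dominates (λ k → WL-boundedBy k (suc s)) (λ k → WL-refines)
  WL⪯C : ∀ s t → 𝐖𝐋 (suc s) ⪯S 𝐂 (suc t)
  WL⪯C s t = dominates (λ k → WL-boundedBy k (suc s)) (λ k → C-refines)
  C⪯WL : ∀ s t → 𝐂 (suc s) ⪯S 𝐖𝐋 (suc t)
  C⪯WL s t = dominates (λ k → C-boundedBy k (suc s)) (λ k → WL-refines)
  C⪯C : ∀ s t → 𝐂 (suc s) ⪯S 𝐂 (suc t)
  C⪯C s t = dominates (λ k → C-boundedBy k (suc s)) (λ k → C-refines)
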